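{- Let $G$ be a finite, simple, undirected, connected graph with $\mathrm{fes}(G) \geq 2$. Then $\mathrm{MEG}(G) \leq 9\,\mathrm{fes}(G) + |L(G)| - 8$, where $L(G)$ is the set of leaves (vertices of degree $1$) of $G$.
   Context: Two vertices $x,y$ of $G$ monitor an edge $e$ if $e$ belongs to all shortest paths between $x$ and $y$. A set $S\subseteq V(G)$ is a monitoring edge-geodetic set (MEG-set) if for every edge $e$ of $G$ there is a pair $x,y\in S$ that monitors $e$. $\mathrm{MEG}(G)$ denotes the minimum size of an MEG-set of $G$. A feedback edge set of $G$ is a set of edges whose removal leaves a forest; $\mathrm{fes}(G)$ is the minimum size of a feedback edge set of $G$. -}

module Defs where

open import Data.Nat using (ℕ; zero; suc; _+_; _*_; _∸_; _≤_; _<_; _≡ᵇ_)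
open import Data.Bool using (Bool; true; false)
open import Data.Fin using (Fin; toℕ; inject₁; fromℕ) renaming (zero to fzero; suc to fsuc)
open import Data.Fin.Subset using (Subset; ∣_∣) renaming (_∈_ to _∈ₛ_)
open import Data.Vec using (tabulate)
open import Data.List using (List; length)
open import Data.List.Membership.Propositional using (_∈_)
open import Data.List.Relation.Unary.All using (All)
open import Data.List.Relation.Unary.Unique.Propositional using (Unique)
open import Data.Product using (Σ; ∃; _×_; _,_)
open import Data.Sum using (_⊎_)
open import Relation.Nullary using (¬_)
open import Relation.Binary.PropositionalEquality using (_≡_)
open import Function.Definitions using (Injective)

record Graph (n : ℕ) : Set where
  field
    adj   : Fin n → Fin n → Bool
    sym   : ∀ u v → adj u v ≡ adj v u
    irref : ∀ v → adj v v ≡ false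

open Graph public

module _ {n : ℕ} (G : Graph n) where

  Adj : Fin n → Fin n → Set
  Adj u v = adj G u v ≡ true

  data Walk : Fin n → Fin n → Set where
    []  : ∀ {x} → Walk x x
    _∷_ : ∀ {x y z} → Adj x y → Walk y z → Walk x z

  walkLength : ∀ {x y} → Walk x y → ℕ
  walkLength []      = 0
  walkLength (_ ∷ w) = suc (walkLength w)

  data UsesEdge (u v : Fin n) : ∀ {x y} → Walk x y → Set where
    here  : ∀ {x y z} (e : Adj x y) (w : Walk y z) →
            ((x ≡ u × y ≡ v) ⊎ (x ≡ v × y ≡ u)) → UsesEdge u v (e ∷ w)
    there : ∀ {x y z} (e : Adj x y) (w : Walk y z) →
            UsesEdge u v w → UsesEdge u v (e ∷ w)

  -- a shortest x–y walk (shortest walks are exactly the shortest paths)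
  IsShortest : ∀ {x y} → Walk x y → Set
  IsShortest {x} {y} w = ∀ (w' : Walk x y) → walkLength w ≤ walkLength w'

  Connected : Set
  Connected = ∀ x y → Walk x y

  Monitors : Fin n → Fin n → Fin n → Fin n → Set
  Monitors x y u v = ∀ (w : Walk x y) → IsShortest w → UsesEdge u v w

  IsMEGSet : Subset n → Set
  IsMEGSet S = ∀ u v → Adj u v →
    Σ (Fin n) λ x → Σ (Fin n) λ y → x ∈ₛ S × y ∈ₛ S × Monitors x y u v

  degree : Fin n → ℕ
  degree v = ∣ tabulate (adj G v) ∣

  numLeaves : ℕ
  numLeaves = ∣ tabulate (λ v → degree v ≡ᵇ 1) ∣

  -- a set of edges of G, each edge {u,v} listed once as (u,v) with u < v
  IsEdgeSet : List (Fin n × Fin n) → Set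
  IsEdgeSet F = Unique F × All (λ { (u , v) → toℕ u < toℕ v × Adj u v }) F

  AdjMinus : List (Fin n × Fin n) → Fin n → Fin n → Set
  AdjMinus F u v = Adj u v × ¬ ((u , v) ∈ F ⊎ (v , u) ∈ F)

  HasCycle : (Fin n → Fin n → Set) → Set
  HasCycle R = ∃ λ (k : ℕ) → Σ (Fin (suc (suc (suc k))) → Fin n) λ c →
    Injective _≡_ _≡_ c ×
    (∀ (i : Fin (suc (suc k))) → R (c (inject₁ i)) (c (fsuc i))) ×
    R (c (fromℕ (suc (suc k)))) (c fzero)

  IsForestAfterRemoving : List (Fin n × Fin n) → Set
  IsForestAfterRemoving F = ¬ HasCycle (AdjMinus F)

  IsFeedbackEdgeSet : List (Fin n × Fin n) → Set
  IsFeedbackEdgeSet F = IsEdgeSet F × IsForestAfterRemoving F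

  -- F is a minimum feedback edge set, i.e. fes(G) = length F
  IsMinFeedbackEdgeSet : List (Fin n × Fin n) → Set
  IsMinFeedbackEdgeSet F = IsFeedbackEdgeSet F ×
    (∀ F' → IsFeedbackEdgeSet F' → length F ≤ length F')

{-# OPTIONS --safe #-}
-- Fix a root r and let T be a breadth-first spanning tree.  Let S consist of r,
-- the leaves, and, for every non-tree edge, its two endpoints together with the
-- T-parent of the endpoint farther from r.  Both endpoints of a non-tree edge lie
-- in S.  If a tree edge {v , par v} does not have both endpoints in S, then par v
-- is the only neighbour of v closer to r; descending from v through such vertices
-- one reaches some x ∈ S all of whose geodesics to r traverse {v , par v}, so x
-- and r monitor it.  A forest has at most n − 1 edges, so the number of non-tree
-- edges is at most k = fes(G), and |S| ≤ 3k + |L| + 1 ≤ 9k + |L| − 8 for k ≥ 2.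
module Submission where

open import Defs
open import Data.Bool using (true)
import Data.Bool.Properties as Bool
open import Data.Nat using (ℕ; zero; suc; _+_; _*_; _∸_; _≤_; _<_; z≤n; s≤s; _≡ᵇ_)
open import Data.Nat.Properties
open import Data.Nat.Tactic.RingSolver using (solve-∀)
open import Data.Fin using (Fin; toℕ; inject₁; fromℕ) renaming (zero to fzero; suc to fsuc)
import Data.Fin.Properties as Fin
open import Data.Fin.Subset using (Subset; ∣_∣; ⁅_⁆; _∪_; _-_; ⊤; inside; outside) renaming (_∈_ to _∈ₛ_)
import Data.Fin.Subset.Properties as Subset
open import Data.List using (List; []; _∷_; _++_; length; map; filter; concatMap; foldr; allFin; cartesianProduct)
open import Data.List.Properties using (length-++; length-map; length-tabulate)
open import Data.List.Membership.Propositional using (_∈_; _∉_; lose)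
open import Data.List.Membership.Propositional.Properties
import Data.List.Membership.DecPropositional as DecMembership
open import Data.List.Relation.Unary.All using (All; []; _∷_)
import Data.List.Relation.Unary.All as All
open import Data.List.Relation.Unary.AllPairs using ([]; _∷_)
open import Data.List.Relation.Unary.Any using (here; there)
open import Data.List.Relation.Unary.Unique.Propositional using (Unique)
import Data.List.Relation.Unary.Unique.Propositional.Properties as Unique
open import Data.Product using (Σ; ∃; _×_; _,_; proj₁; proj₂; -,_)
open import Data.Product.Properties using (≡-dec)
open import Data.Sum using (_⊎_; inj₁; inj₂; swap)
import Data.Sum as Sum
open import Data.Vec using ([]; _∷_; tabulate)
open import Data.Vec.Properties using (lookup∘tabulate; []=⇒lookup; lookup⇒[]=)
open import Function using (_∘_; id)
open import Function.Definitions using (Injective)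
open import Relation.Binary using (Rel)
open import Relation.Binary.Construct.Closure.ReflexiveTransitive as Star using (Star; ε; _◅_; _◅◅_)
open import Relation.Binary.PropositionalEquality using (_≡_; _≢_; refl; trans; cong; subst; ≢-sym) renaming (sym to ≡-sym)
open import Relation.Nullary using (¬_; Dec; yes; no; contradiction; ¬?; _×-dec_; _⊎-dec_)
open import Relation.Nullary.Decidable using (map′)
open import Relation.Unary using (Pred; Decidable)

-- Counting in lists and finite subsets

module _ {a} {A : Set a} where

  ∈-++-delete : ∀ {x y : A} xs {zs} → y ∈ xs ++ x ∷ zs → y ≢ x → y ∈ xs ++ zs
  ∈-++-delete xs {zs} y∈ y≢x with ∈-++⁻ xs y∈
  ... | inj₁ y∈xs         = ∈-++⁺ˡ y∈xs
  ... | inj₂ (here y≡x)   = contradiction y≡x y≢x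
  ... | inj₂ (there y∈zs) = ∈-++⁺ʳ xs y∈zs

  -- Pigeonhole: after one occurrence of the head is cut out of `ys`, the tail still fits into the
  -- rest, because uniqueness keeps it away from the head.
  unique-⊆⇒length≤ : ∀ {xs ys : List A} → Unique xs → (∀ {x} → x ∈ xs → x ∈ ys) → length xs ≤ length ys
  unique-⊆⇒length≤ {[]}     _           _     = z≤n
  unique-⊆⇒length≤ {x ∷ xs} (x# ∷ uniq) xs⊆ys with ∈-∃++ (xs⊆ys (here refl))
  ... | ys , zs , refl = begin
    suc (length xs)             ≤⟨ s≤s (unique-⊆⇒length≤ uniq xs⊆) ⟩
    suc (length (ys ++ zs))     ≡⟨ cong suc (length-++ ys) ⟩
    suc (length ys + length zs) ≡⟨ +-suc (length ys) (length zs) ⟨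
    length ys + suc (length zs) ≡⟨ length-++ ys ⟨
    length (ys ++ x ∷ zs)       ∎
    where
    open ≤-Reasoning
    xs⊆ : ∀ {y} → y ∈ xs → y ∈ ys ++ zs
    xs⊆ y∈xs = ∈-++-delete ys (xs⊆ys (there y∈xs)) (≢-sym (All.lookup x# y∈xs))

least : ∀ {p} {P : Pred ℕ p} → Decidable P → ∀ m → P m → ∃ λ k → P k × (∀ j → P j → k ≤ j)
least P? m pm with P? 0
least P? m       pm | yes p0 = 0 , p0 , λ _ _ → z≤n
least P? zero    pm | no ¬p0 = contradiction pm ¬p0
least P? (suc m) pm | no ¬p0 with least (P? ∘ suc) m pm
... | k , pk , k≤ = suc k , pk , λ where
  zero    p0 → contradiction p0 ¬p0
  (suc j) pj → s≤s (k≤ j pj)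

bounded : ∀ {n} (f : Fin n → ℕ) → ∃ λ m → ∀ i → f i ≤ m
bounded {zero}  f = 0 , λ ()
bounded {suc n} f with bounded (f ∘ fsuc)
... | m , f≤m = f fzero + m , λ where
  fzero    → m≤m+n _ m
  (fsuc i) → ≤-trans (f≤m i) (m≤n+m m _)

∣p∪q∣≤∣p∣+∣q∣ : ∀ {n} (p q : Subset n) → ∣ p ∪ q ∣ ≤ ∣ p ∣ + ∣ q ∣
∣p∪q∣≤∣p∣+∣q∣ []            []            = z≤n
∣p∪q∣≤∣p∣+∣q∣ (outside ∷ p) (outside ∷ q) = ∣p∪q∣≤∣p∣+∣q∣ p q
∣p∪q∣≤∣p∣+∣q∣ (outside ∷ p) (inside ∷ q)  = ≤-trans (s≤s (∣p∪q∣≤∣p∣+∣q∣ p q)) (≤-reflexive (≡-sym (+-suc ∣ p ∣ ∣ q ∣)))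
∣p∪q∣≤∣p∣+∣q∣ (inside ∷ p)  (outside ∷ q) = s≤s (∣p∪q∣≤∣p∣+∣q∣ p q)
∣p∪q∣≤∣p∣+∣q∣ (inside ∷ p)  (inside ∷ q)  = s≤s (≤-trans (∣p∪q∣≤∣p∣+∣q∣ p q) (+-monoʳ-≤ ∣ p ∣ (n≤1+n ∣ q ∣)))

-- The new elements come as a list so that its length bounds the growth in size; repetitions do no
-- harm.
adjoin : ∀ {n} → List (Fin n) → Subset n → Subset n
adjoin xs p = foldr (λ x q → ⁅ x ⁆ ∪ q) p xs

∈-adjoinˡ : ∀ {n x} {xs : List (Fin n)} p → x ∈ xs → x ∈ₛ adjoin xs p
∈-adjoinˡ p (here refl)  = Subset.x∈p∪q⁺ (inj₁ (Subset.x∈⁅x⁆ _))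
∈-adjoinˡ p (there x∈xs) = Subset.x∈p∪q⁺ (inj₂ (∈-adjoinˡ p x∈xs))

∈-adjoinʳ : ∀ {n x} (xs : List (Fin n)) {p} → x ∈ₛ p → x ∈ₛ adjoin xs p
∈-adjoinʳ []       x∈p = x∈p
∈-adjoinʳ (_ ∷ xs) x∈p = Subset.x∈p∪q⁺ (inj₂ (∈-adjoinʳ xs x∈p))

∣adjoin∣≤ : ∀ {n} (xs : List (Fin n)) p → ∣ adjoin xs p ∣ ≤ length xs + ∣ p ∣
∣adjoin∣≤ []       p = ≤-refl
∣adjoin∣≤ (x ∷ xs) p = begin
  ∣ ⁅ x ⁆ ∪ adjoin xs p ∣     ≤⟨ ∣p∪q∣≤∣p∣+∣q∣ ⁅ x ⁆ (adjoin xs p) ⟩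
  ∣ ⁅ x ⁆ ∣ + ∣ adjoin xs p ∣ ≡⟨ cong (_+ ∣ adjoin xs p ∣) (Subset.∣⁅x⁆∣≡1 x) ⟩
  suc ∣ adjoin xs p ∣         ≤⟨ s≤s (∣adjoin∣≤ xs p) ⟩
  suc (length xs + ∣ p ∣)     ∎
  where open ≤-Reasoning

∈-tabulate⁺ₛ : ∀ {n} {f} {x : Fin n} → f x ≡ true → x ∈ₛ tabulate f
∈-tabulate⁺ₛ {f = f} {x} fx = lookup⇒[]= x (tabulate f) (trans (lookup∘tabulate f x) fx)

∈-tabulate⁻ₛ : ∀ {n} {f} {x : Fin n} → x ∈ₛ tabulate f → f x ≡ true
∈-tabulate⁻ₛ {f = f} {x} x∈ = trans (≡-sym (lookup∘tabulate f x)) ([]=⇒lookup x∈)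

-- Simple paths and the edge bound for forests

module _ {ℓ n} (R : Rel (Fin n) ℓ) where

  -- Shaped like the cycles of `HasCycle`: a path with at least two edges becomes such a cycle once
  -- its ends are joined.
  record SimplePath (x z : Fin n) : Set ℓ where
    field
      len    : ℕ
      vertex : Fin (suc len) → Fin n
      inj    : Injective _≡_ _≡_ vertex
      step   : ∀ i → R (vertex (inject₁ i)) (vertex (fsuc i))
      first  : vertex fzero ≡ x
      last   : vertex (fromℕ len) ≡ z

module _ {ℓ n} {R : Rel (Fin n) ℓ} where

  trivialPath : ∀ x → SimplePath R x x
  trivialPath x = record
    { len = 0 ; vertex = λ _ → x ; inj = λ { {fzero} {fzero} _ → refl }
    ; step = λ () ; first = refl ; last = refl }

  suffix : ∀ k (f : Fin (suc k) → Fin n) → Injective _≡_ _≡_ f →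
           (∀ i → R (f (inject₁ i)) (f (fsuc i))) → ∀ i → SimplePath R (f i) (f (fromℕ k))
  suffix k       f inj step fzero    = record
    { len = k ; vertex = f ; inj = inj ; step = step ; first = refl ; last = refl }
  suffix (suc k) f inj step (fsuc i) =
    suffix k (f ∘ fsuc) (Fin.suc-injective ∘ inj) (step ∘ fsuc) i

  -- If `x` already lies on the path, the suffix from `x` cuts off the loop; otherwise `x` becomes a
  -- new first vertex.
  prepend : ∀ {x y z} → R x y → SimplePath R y z → SimplePath R x z
  prepend {x} Rxy record { len = len ; vertex = vertex ; inj = inj ; step = step ; first = refl ; last = refl }
    with Fin.any? (λ i → vertex i Fin.≟ x)
  ... | yes (i , refl) = suffix len vertex inj step i
  ... | no x∉p = record
    { len = suc len
    ; vertex = vertex′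
    ; inj = inj′
    ; step = λ { fzero → Rxy ; (fsuc i) → step i }
    ; first = refl
    ; last = refl }
    where
    vertex′ : Fin (suc (suc len)) → Fin n
    vertex′ fzero    = x
    vertex′ (fsuc i) = vertex i
    inj′ : Injective _≡_ _≡_ vertex′
    inj′ {fzero}  {fzero}  _  = refl
    inj′ {fzero}  {fsuc j} eq = contradiction (j , ≡-sym eq) x∉p
    inj′ {fsuc i} {fzero}  eq = contradiction (i , eq) x∉p
    inj′ {fsuc i} {fsuc j} eq = cong fsuc (inj eq)

  simplePath : ∀ {x z} → Star R x z → SimplePath R x z
  simplePath ε          = trivialPath _
  simplePath (Rxy ◅ ps) = prepend Rxy (simplePath ps)

module _ {n : ℕ} where

  Edge : Set
  Edge = Fin n × Fin n

  Joined : List Edge → Fin n → Fin n → Set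
  Joined E u v = (u , v) ∈ E ⊎ (v , u) ∈ E

  Ordered : Edge → Set
  Ordered (u , v) = toℕ u < toℕ v

  -- Invariant for inserting the edges of a forest one by one, as in union-find: `labels` contains
  -- every label in use, starts as all vertices and loses an element per edge.
  record Components (E : List Edge) : Set where
    field
      label     : Fin n → Fin n
      labels    : Subset n
      label∈    : ∀ x → label x ∈ₛ labels
      connected : ∀ x y → label x ≡ label y → Star (Joined E) x y
      count     : ∣ labels ∣ + length E ≤ n

  module _ {R : Fin n → Fin n → Set} (G : Graph n) (R-sym : ∀ {u v} → R u v → R v u) (acyclic : ¬ HasCycle G R) where

    -- A path without edges would force `u ≡ v`, a single edge would already join `u` and `v`, and
    -- any longer path is closed to a cycle by the edge from `v` back to `u`.
    ¬closing-edge : ∀ {E u v} → (∀ {a b} → Joined E a b → R a b) → R u v → u ≢ v →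
                    ¬ Joined E u v → ¬ SimplePath (Joined E) u v
    ¬closing-edge E⊆R Ruv u≢v ¬uv record { len = zero ; first = refl ; last = refl } = u≢v refl
    ¬closing-edge E⊆R Ruv u≢v ¬uv record { len = suc zero ; step = step ; first = refl ; last = refl } = ¬uv (step fzero)
    ¬closing-edge E⊆R Ruv u≢v ¬uv record { len = suc (suc k) ; vertex = c ; inj = inj ; step = step ; first = refl ; last = refl } =
      acyclic (k , c , inj , E⊆R ∘ step , R-sym Ruv)

    components : ∀ E → Unique E → All Ordered E → All (λ { (u , v) → R u v }) E → Components E
    components [] _ _ _ = record
      { label = id ; labels = ⊤ ; label∈ = λ _ → Subset.∈⊤
      ; connected = λ { x _ refl → ε }
      ; count = ≤-reflexive (trans (+-identityʳ _) (Subset.∣⊤∣≡n n)) }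
    components ((u , v) ∷ E) (e∉E ∷ uniq) (u<v ∷ ord) (Ruv ∷ E⊆R) = record
      { label = merge ; labels = labels - label v ; label∈ = merge∈
      ; connected = connected′ ; count = count′ }
      where
      open Components (components E uniq ord E⊆R)

      joined⇒R : ∀ {a b} → Joined E a b → R a b
      joined⇒R (inj₁ ab∈E) = All.lookup E⊆R ab∈E
      joined⇒R (inj₂ ba∈E) = R-sym (All.lookup E⊆R ba∈E)

      new : ¬ Joined E u v
      new (inj₁ uv∈E) = All.lookup e∉E uv∈E refl
      new (inj₂ vu∈E) = <-asym u<v (All.lookup ord vu∈E)

      -- Ends with equal labels would already be connected, and the new edge would close a cycle.
      lu≢lv : label u ≢ label v
      lu≢lv eq = ¬closing-edge joined⇒R Ruv (λ { refl → <-irrefl refl u<v }) new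
                   (simplePath (connected u v eq))

      merge : Fin n → Fin n
      merge x with label x Fin.≟ label v
      ... | yes _ = label u
      ... | no _  = label x

      merge∈ : ∀ x → merge x ∈ₛ labels - label v
      merge∈ x with label x Fin.≟ label v
      ... | yes _   = Subset.x∈p∧x≢y⇒x∈p-y (label∈ u) lu≢lv
      ... | no x≢lv = Subset.x∈p∧x≢y⇒x∈p-y (label∈ x) x≢lv

      lift : ∀ {x y} → label x ≡ label y → Star (Joined ((u , v) ∷ E)) x y
      lift eq = Star.map (Sum.map there there) (connected _ _ eq)

      connected′ : ∀ x y → merge x ≡ merge y → Star (Joined ((u , v) ∷ E)) x y
      connected′ x y eq with label x Fin.≟ label v | label y Fin.≟ label v
      ... | yes x~v | yes y~v = lift (trans x~v (≡-sym y~v))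
      -- Here `x` comes from the old class of `v` and `y` from that of `u`, so the connection
      -- crosses the new edge.
      ... | yes x~v | no _    = lift x~v ◅◅ inj₂ (here refl) ◅ lift eq
      ... | no _    | yes y~v = lift eq ◅◅ inj₁ (here refl) ◅ lift (≡-sym y~v)
      ... | no _    | no _    = lift eq

      count′ : ∣ labels - label v ∣ + suc (length E) ≤ n
      count′ = begin
        ∣ labels - label v ∣ + suc (length E) ≡⟨ +-suc _ (length E) ⟩
        suc ∣ labels - label v ∣ + length E   ≤⟨ +-monoˡ-≤ (length E) (Subset.x∈p⇒∣p-x∣<∣p∣ (label∈ v)) ⟩
        ∣ labels ∣ + length E                 ≤⟨ count ⟩
        n                                     ∎
        where open ≤-Reasoning

    -- The vertex `r` shows that at least one label survives, which makes the bound strict.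
    forest-length< : Fin n → ∀ E → Unique E → All Ordered E → All (λ { (u , v) → R u v }) E → length E < n
    forest-length< r E uniq ord E⊆R = ≤-trans (+-monoˡ-≤ (length E) 1≤∣labels∣) count
      where
      open Components (components E uniq ord E⊆R)
      1≤∣labels∣ : 1 ≤ ∣ labels ∣
      1≤∣labels∣ = ≤-trans (s≤s z≤n) (Subset.x∈p⇒∣p-x∣<∣p∣ (label∈ r))

-- Breadth-first search from a root

module BFS {n : ℕ} (G : Graph n) (conn : Connected G) (r : Fin n) where

  Adj-sym : ∀ {u v} → Adj G u v → Adj G v u
  Adj-sym {u} {v} = trans (Graph.sym G v u)

  Adj⇒≢ : ∀ {u v} → Adj G u v → u ≢ v
  Adj⇒≢ {u} uu refl with trans (≡-sym uu) (irref G u)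
  ... | ()

  walkOfLength? : ∀ k x → Dec (Σ (Walk G x r) λ w → walkLength G w ≡ k)
  walkOfLength? zero x = map′ (λ { refl → [] , refl }) (λ { ([] , _) → refl }) (x Fin.≟ r)
  walkOfLength? (suc k) x =
    map′ (λ { (y , xy , w , eq) → xy ∷ w , cong suc eq })
         (λ { (xy ∷ w , eq) → -, xy , w , suc-injective eq })
         (Fin.any? λ y → (adj G x y Bool.≟ true) ×-dec walkOfLength? k y)

  abstract
    -- Kept abstract so that the search never unfolds; everything later rests on the stated
    -- properties alone.
    shortest : ∀ x → ∃ λ k → (Σ (Walk G x r) λ w → walkLength G w ≡ k) ×
                             (∀ j → (Σ (Walk G x r) λ w → walkLength G w ≡ j) → k ≤ j)
    shortest x = least (λ k → walkOfLength? k x) (walkLength G (conn x r)) (conn x r , refl)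

  dist : Fin n → ℕ
  dist x = proj₁ (shortest x)

  geodesic : ∀ x → Walk G x r
  geodesic x = proj₁ (proj₁ (proj₂ (shortest x)))

  length-geodesic : ∀ x → walkLength G (geodesic x) ≡ dist x
  length-geodesic x = proj₂ (proj₁ (proj₂ (shortest x)))

  dist≤ : ∀ {x} (w : Walk G x r) → dist x ≤ walkLength G w
  dist≤ {x} w = proj₂ (proj₂ (shortest x)) _ (w , refl)

  IsGeodesic : ∀ {x} → Walk G x r → Set
  IsGeodesic {x} w = walkLength G w ≡ dist x

  shortest⇒geodesic : ∀ {x} {w : Walk G x r} → IsShortest G w → IsGeodesic w
  shortest⇒geodesic {x} {w} sh =
    ≤-antisym (≤-trans (sh (geodesic x)) (≤-reflexive (length-geodesic x))) (dist≤ w)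

  -- If `w` were longer than `dist y`, replacing it by a geodesic from `y` would shorten the whole
  -- walk.
  geodesic-tail : ∀ {x y} {xy : Adj G x y} {w : Walk G y r} → IsGeodesic (xy ∷ w) →
                  IsGeodesic w × suc (dist y) ≡ dist x
  geodesic-tail {x} {y} {xy} {w} eq = w-geo , trans (cong suc (≡-sym w-geo)) eq
    where
    open ≤-Reasoning
    w-geo : IsGeodesic w
    w-geo = ≤-antisym (≤-pred (begin
      suc (walkLength G w)            ≡⟨ eq ⟩
      dist x                          ≤⟨ dist≤ (xy ∷ geodesic y) ⟩
      suc (walkLength G (geodesic y)) ≡⟨ cong suc (length-geodesic y) ⟩
      suc (dist y)                    ∎)) (dist≤ w)

  second : ∀ {x y} → Walk G x y → Fin n
  second {x} []            = x
  second (_∷_ {y = y} _ _) = y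

  -- The root is its own parent.
  par : Fin n → Fin n
  par x = second (geodesic x)

  par-root : par r ≡ r
  par-root with geodesic r | length-geodesic r
  ... | []     | _  = refl
  ... | _ ∷ _  | eq = contradiction (≤-trans (≤-reflexive eq) (dist≤ [])) λ ()

  par-nonroot : ∀ {x} → x ≢ r → Adj G x (par x) × suc (dist (par x)) ≡ dist x
  par-nonroot {x} x≢r with geodesic x | length-geodesic x
  ... | []     | _  = contradiction refl x≢r
  ... | xy ∷ w | eq = xy , proj₂ (geodesic-tail {xy = xy} {w} eq)

  Adj-par⇒≢r : ∀ {x} → Adj G x (par x) → x ≢ r
  Adj-par⇒≢r x~p refl = Adj⇒≢ x~p (≡-sym par-root)

  -- A parent is strictly closer to the root, so two non-roots cannot be parents of each other; if
  -- one vertex is the root, its being its own parent forces equality.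
  par-antisym : ∀ {x y} → par x ≡ y → par y ≡ x → x ≡ y
  par-antisym {x} {y} px py with x Fin.≟ r | y Fin.≟ r
  ... | yes x≡r | _       = trans x≡r (trans (≡-sym par-root) (trans (cong par (≡-sym x≡r)) px))
  ... | no _    | yes y≡r = trans (≡-sym py) (trans (cong par y≡r) (trans par-root (≡-sym y≡r)))
  ... | no x≢r  | no y≢r  = contradiction (closer x≢r px) (<-asym (closer y≢r py))
    where
    closer : ∀ {a b} → a ≢ r → par a ≡ b → dist b < dist a
    closer a≢r refl = ≤-reflexive (proj₂ (par-nonroot a≢r))

  -- Forced passages of geodesics and monitoring

  ParentUnique : Fin n → Set
  ParentUnique v = ∀ {q} → Adj G v q → suc (dist q) ≡ dist v → q ≡ par v

  -- Every geodesic from x to r passes through u.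
  Through : Fin n → Fin n → Set
  Through x u = (w : Walk G x r) → IsGeodesic w →
    Σ (Walk G u r) λ w′ → IsGeodesic w′ × (∀ {a b} → UsesEdge G a b w′ → UsesEdge G a b w)

  through-refl : ∀ x → Through x x
  through-refl x w geo = w , geo , id

  -- Past `v` a geodesic must step to a neighbour one level closer, and `par v` is the only one; its
  -- tail is again geodesic.
  through-par : ∀ {x v} → v ≢ r → ParentUnique v → Through x v → Through x (par v)
  through-par v≢r uniq thr w geo with thr w geo
  ... | []      , _    , _    = contradiction refl v≢r
  ... | vq ∷ w′ , geo′ , uses with geodesic-tail {xy = vq} {w′} geo′
  ... | geo″ , dq with uniq vq dq
  ... | refl = w′ , geo″ , uses ∘ there vq w′

  -- Any shortest walk contains the edges of a geodesic from `v`, whose first step can only go to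
  -- `par v`.
  through⇒monitors : ∀ {x v} → v ≢ r → ParentUnique v → Through x v → Monitors G x r v (par v)
  through⇒monitors v≢r uniq thr w sh with thr w (shortest⇒geodesic sh)
  ... | []      , _    , _    = contradiction refl v≢r
  ... | vq ∷ w′ , geo′ , uses =
    uses (here vq w′ (inj₁ (refl , uniq vq (proj₂ (geodesic-tail {xy = vq} {w′} geo′)))))

  endpoints-monitor : ∀ {u v} → Adj G u v → Monitors G u v u v
  endpoints-monitor uv []            _  = contradiction refl (Adj⇒≢ uv)
  endpoints-monitor uv (e ∷ [])      _  = here e [] (inj₁ (refl , refl))
  endpoints-monitor uv (e ∷ e′ ∷ w) sh = contradiction (sh (uv ∷ [])) λ { (s≤s ()) }

  usesEdge-swap : ∀ {u v x y} {w : Walk G x y} → UsesEdge G u v w → UsesEdge G v u w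
  usesEdge-swap (here e w eq)  = here e w (swap eq)
  usesEdge-swap (there e w us) = there e w (usesEdge-swap us)

  -- Counting tree and non-tree edges

  NonTree : Fin n → Fin n → Set
  NonTree u v = ¬ (par u ≡ v ⊎ par v ≡ u)

  IsEdge : Fin n × Fin n → Set
  IsEdge (u , v) = toℕ u < toℕ v × Adj G u v

  isEdge? : Decidable IsEdge
  isEdge? (u , v) = (toℕ u <? toℕ v) ×-dec (adj G u v Bool.≟ true)

  edges : List (Fin n × Fin n)
  edges = filter isEdge? (cartesianProduct (allFin n) (allFin n))

  edges-unique : Unique edges
  edges-unique = Unique.filter⁺ isEdge? (Unique.cartesianProduct⁺ (Unique.allFin⁺ n) (Unique.allFin⁺ n))

  ∈-edges⁺ : ∀ {e} → IsEdge e → e ∈ edges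
  ∈-edges⁺ = ∈-filter⁺ isEdge? (∈-cartesianProduct⁺ (∈-allFin _) (∈-allFin _))

  ∈-edges⁻ : ∀ {e} → e ∈ edges → IsEdge e
  ∈-edges⁻ e∈ = proj₂ (∈-filter⁻ isEdge? {xs = cartesianProduct (allFin n) (allFin n)} e∈)

  nonTreeEdge? : (e : Fin n × Fin n) → Dec (NonTree (proj₁ e) (proj₂ e))
  nonTreeEdge? (u , v) = ¬? ((par u Fin.≟ v) ⊎-dec (par v Fin.≟ u))

  nonTreeEdges : List (Fin n × Fin n)
  nonTreeEdges = filter nonTreeEdge? edges

  orient : Fin n → Fin n → Fin n × Fin n
  orient u v with toℕ u <? toℕ v
  ... | yes _ = u , v
  ... | no _  = v , u

  orient-cases : ∀ u v → orient u v ≡ (u , v) ⊎ orient u v ≡ (v , u)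
  orient-cases u v with toℕ u <? toℕ v
  ... | yes _ = inj₁ refl
  ... | no _  = inj₂ refl

  orient-isEdge : ∀ {u v} → Adj G u v → IsEdge (orient u v)
  orient-isEdge {u} {v} uv with toℕ u <? toℕ v
  ... | yes u<v = u<v , uv
  ... | no u≮v  = ≤∧≢⇒< (≮⇒≥ u≮v) (Adj⇒≢ uv ∘ ≡-sym ∘ Fin.toℕ-injective) , Adj-sym uv

  treeEdge : Fin n → Fin n × Fin n
  treeEdge v = orient v (par v)

  -- Equal edges listed from opposite ends would make `v` and `w` parents of each other, which
  -- `par-antisym` handles.
  treeEdge-injective : ∀ {v w} → treeEdge v ≡ treeEdge w → v ≡ w
  treeEdge-injective {v} {w} eq with orient-cases v (par v) | orient-cases w (par w)
  ... | inj₁ p | inj₁ q = cong proj₁ (trans (≡-sym p) (trans eq q))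
  ... | inj₂ p | inj₂ q = cong proj₂ (trans (≡-sym p) (trans eq q))
  ... | inj₁ p | inj₂ q = let e = trans (≡-sym p) (trans eq q) in
    par-antisym (cong proj₂ e) (≡-sym (cong proj₁ e))
  ... | inj₂ p | inj₁ q = let e = trans (≡-sym p) (trans eq q) in
    par-antisym (cong proj₁ e) (≡-sym (cong proj₂ e))

  nonroot? : Decidable (_≢ r)
  nonroot? v = ¬? (v Fin.≟ r)

  nonroots : List (Fin n)
  nonroots = filter nonroot? (allFin n)

  treeEdges : List (Fin n × Fin n)
  treeEdges = map treeEdge nonroots

  n≤1+∣treeEdges∣ : n ≤ suc (length treeEdges)
  n≤1+∣treeEdges∣ = begin
    n                       ≡⟨ length-tabulate {n = n} id ⟨
    length (allFin n)       ≤⟨ unique-⊆⇒length≤ (Unique.allFin⁺ n) (λ {x} _ → covered x) ⟩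
    suc (length nonroots)   ≡⟨ cong suc (length-map treeEdge nonroots) ⟨
    suc (length treeEdges)  ∎
    where
    open ≤-Reasoning
    covered : ∀ x → x ∈ r ∷ nonroots
    covered x with x Fin.≟ r
    ... | yes x≡r = here x≡r
    ... | no x≢r  = there (∈-filter⁺ nonroot? (∈-allFin x) x≢r)

  -- Count the edges twice: at least n - 1 of them are tree edges, while at most n - 1 survive the
  -- removal of `F`. Adding `n` to both sides avoids truncated subtraction.
  ∣nonTreeEdges∣≤ : ∀ {F} → IsFeedbackEdgeSet G F → length nonTreeEdges ≤ length F
  ∣nonTreeEdges∣≤ {F} ((_ , F-edges) , forest) = +-cancelʳ-≤ n _ _ (begin
    length nonTreeEdges + n                          ≤⟨ +-monoʳ-≤ (length nonTreeEdges) n≤1+∣treeEdges∣ ⟩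
    length nonTreeEdges + suc (length treeEdges)     ≡⟨ +-suc _ _ ⟩
    suc (length nonTreeEdges + length treeEdges)     ≡⟨ cong suc (length-++ nonTreeEdges) ⟨
    suc (length (nonTreeEdges ++ treeEdges))         ≤⟨ s≤s (unique-⊆⇒length≤ all-unique all⊆) ⟩
    suc (length (F ++ kept))                         ≡⟨ cong suc (length-++ F) ⟩
    suc (length F + length kept)                     ≡⟨ +-suc _ _ ⟨
    length F + suc (length kept)                     ≤⟨ +-monoʳ-≤ (length F) kept<n ⟩
    length F + n                                     ∎)
    where
    open ≤-Reasoning
    open DecMembership (≡-dec (Fin._≟_ {n}) (Fin._≟_ {n})) using (_∈?_)

    kept : List (Fin n × Fin n)
    kept = filter (λ e → ¬? (e ∈? F)) edges

    kept⁻ : ∀ {e} → e ∈ kept → IsEdge e × e ∉ F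
    kept⁻ e∈ with ∈-filter⁻ (λ e → ¬? (e ∈? F)) {xs = edges} e∈
    ... | e∈edges , e∉F = ∈-edges⁻ e∈edges , e∉F

    kept-AdjMinus : ∀ {e} → e ∈ kept → AdjMinus G F (proj₁ e) (proj₂ e)
    kept-AdjMinus e∈ with kept⁻ e∈
    ... | (u<v , uv) , uv∉F = uv , λ where
      (inj₁ uv∈F) → uv∉F uv∈F
      (inj₂ vu∈F) → <-asym u<v (proj₁ (All.lookup F-edges vu∈F))

    kept<n : length kept < n
    kept<n = forest-length< G (λ { (uv , uv∉F) → Adj-sym uv , uv∉F ∘ swap })
      forest r kept (Unique.filter⁺ (λ e → ¬? (e ∈? F)) edges-unique)
      (All.tabulate (proj₁ ∘ proj₁ ∘ kept⁻)) (All.tabulate kept-AdjMinus)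

    disjoint : ∀ {e} → ¬ (e ∈ nonTreeEdges × e ∈ treeEdges)
    disjoint (e∈N , e∈T) with ∈-map⁻ treeEdge e∈T | ∈-filter⁻ nonTreeEdge? {xs = edges} e∈N
    -- Abstracting the oriented pair lets both orientations be matched; in each, one end is the
    -- parent of the other.
    ... | v , _ , refl | _ , nonTree with orient v (par v) | orient-cases v (par v)
    ... | _ | inj₁ refl = nonTree (inj₁ refl)
    ... | _ | inj₂ refl = nonTree (inj₂ refl)

    all-unique : Unique (nonTreeEdges ++ treeEdges)
    all-unique = Unique.++⁺ (Unique.filter⁺ nonTreeEdge? edges-unique)
      (Unique.map⁺ treeEdge-injective (Unique.filter⁺ nonroot? (Unique.allFin⁺ n))) disjoint

    edges⊆ : ∀ {e} → e ∈ edges → e ∈ F ++ kept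
    edges⊆ {e} e∈ with e ∈? F
    ... | yes e∈F = ∈-++⁺ˡ e∈F
    ... | no e∉F  = ∈-++⁺ʳ F (∈-filter⁺ (λ e → ¬? (e ∈? F)) e∈ e∉F)

    all⊆ : ∀ {e} → e ∈ nonTreeEdges ++ treeEdges → e ∈ F ++ kept
    all⊆ e∈ with ∈-++⁻ nonTreeEdges e∈
    ... | inj₁ e∈N = edges⊆ (proj₁ (∈-filter⁻ nonTreeEdge? {xs = edges} e∈N))
    ... | inj₂ e∈T with ∈-map⁻ treeEdge e∈T
    ... | v , v∈ , refl = edges⊆ (∈-edges⁺ (orient-isEdge (proj₁ (par-nonroot
            (proj₂ (∈-filter⁻ nonroot? {xs = allFin n} v∈))))))

  -- The monitoring set

  -- A tie is broken arbitrarily: the value matters only for ends on consecutive levels.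
  farther : Fin n → Fin n → Fin n
  farther u v with dist u <? dist v
  ... | yes _ = v
  ... | no _  = u

  -- Both argument orders are covered because edges are listed by vertex index, not by distance.
  farther-of-parent : ∀ {q v} → suc (dist q) ≡ dist v → farther q v ≡ v × farther v q ≡ v
  farther-of-parent {q} {v} eq with dist q <? dist v | dist v <? dist q
  ... | no dq≮dv | _         = contradiction (≤-reflexive eq) dq≮dv
  ... | yes dq<dv | yes dv<dq = contradiction dv<dq (<-asym dq<dv)
  ... | yes _     | no _      = refl , refl

  -- The third entry ensures that a vertex with two neighbours one level closer enters `megSet`
  -- together with its parent.
  triple : Fin n × Fin n → List (Fin n)
  triple (u , v) = u ∷ v ∷ par (farther u v) ∷ []

  length-triples : ∀ es → length (concatMap triple es) ≡ 3 * length es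
  length-triples []       = refl
  length-triples (e ∷ es) = trans (cong (3 +_) (length-triples es)) (≡-sym (*-suc 3 (length es)))

  leaves : Subset n
  leaves = tabulate (λ v → degree G v ≡ᵇ 1)

  chosen : List (Fin n)
  chosen = r ∷ concatMap triple nonTreeEdges

  megSet : Subset n
  megSet = adjoin chosen leaves

  root∈megSet : r ∈ₛ megSet
  root∈megSet = ∈-adjoinˡ {xs = chosen} leaves (here refl)

  leaf∈megSet : ∀ {v} → degree G v ≡ 1 → v ∈ₛ megSet
  leaf∈megSet {v} deg≡1 = ∈-adjoinʳ chosen (∈-tabulate⁺ₛ (cong (_≡ᵇ 1) deg≡1))

  triple⊆megSet : ∀ {e x} → e ∈ nonTreeEdges → x ∈ triple e → x ∈ₛ megSet
  triple⊆megSet e∈ x∈ = ∈-adjoinˡ {xs = chosen} leaves (there (∈-concatMap⁺ triple (lose e∈ x∈)))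

  nonTreeEdges⁺ : ∀ {u v} → Adj G u v → NonTree u v → (u , v) ∈ nonTreeEdges ⊎ (v , u) ∈ nonTreeEdges
  nonTreeEdges⁺ {u} {v} uv nt with orient-cases u v | ∈-edges⁺ (orient-isEdge uv)
  ... | inj₁ eq | e∈ = inj₁ (∈-filter⁺ nonTreeEdge? (subst (_∈ edges) eq e∈) nt)
  ... | inj₂ eq | e∈ = inj₂ (∈-filter⁺ nonTreeEdge? (subst (_∈ edges) eq e∈) (nt ∘ swap))

  nonTree⊆megSet : ∀ {u v} → Adj G u v → NonTree u v → u ∈ₛ megSet × v ∈ₛ megSet
  nonTree⊆megSet uv nt with nonTreeEdges⁺ uv nt
  ... | inj₁ e∈ = triple⊆megSet e∈ (here refl) , triple⊆megSet e∈ (there (here refl))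
  ... | inj₂ e∈ = triple⊆megSet e∈ (there (here refl)) , triple⊆megSet e∈ (here refl)

  par∈megSet : ∀ {v q} → Adj G v q → NonTree v q → suc (dist q) ≡ dist v → par v ∈ₛ megSet
  par∈megSet vq nt eq with nonTreeEdges⁺ vq nt | farther-of-parent eq
  ... | inj₁ e∈ | _ , f = triple⊆megSet e∈ (there (there (here (cong par (≡-sym f)))))
  ... | inj₂ e∈ | f , _ = triple⊆megSet e∈ (there (there (here (cong par (≡-sym f)))))

  other-parent-nonTree : ∀ {v q} → Adj G v q → suc (dist q) ≡ dist v → q ≢ par v → NonTree v q
  other-parent-nonTree vq eq q≢p (inj₁ pv≡q) = q≢p (≡-sym pv≡q)
  -- If `q` were a child of `v`, it would be both farther from and closer to the root than `v`.
  other-parent-nonTree {v} {q} vq eq q≢p (inj₂ refl) =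
    <-asym (≤-reflexive eq) (≤-reflexive (proj₂ (par-nonroot (Adj-par⇒≢r (Adj-sym vq)))))

  -- A second closer neighbour `q` would make `v` the farther end of a non-tree edge, whose triple
  -- contains both `v` and `par v`.
  parentUnique : ∀ {v} → ¬ (v ∈ₛ megSet × par v ∈ₛ megSet) → ParentUnique v
  parentUnique {v} ∉S {q} vq eq with q Fin.≟ par v
  ... | yes q≡p = q≡p
  ... | no q≢p  = contradiction (proj₁ (nonTree⊆megSet vq nt) , par∈megSet vq nt eq) ∉S
    where
    nt : NonTree v q
    nt = other-parent-nonTree vq eq q≢p

  -- Otherwise the neighbourhood is exactly the singleton of `p`, and the degree is 1.
  other-neighbour : ∀ {v p} → Adj G v p → degree G v ≢ 1 → ∃ λ w → Adj G v w × w ≢ p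
  other-neighbour {v} {p} vp deg≢1 with Fin.any? (λ w → (adj G v w Bool.≟ true) ×-dec ¬? (w Fin.≟ p))
  ... | yes found = found
  ... | no ¬found = contradiction (trans (cong ∣_∣ singleton) (Subset.∣⁅x⁆∣≡1 p)) deg≢1
    where
    only-p : ∀ {w} → Adj G v w → w ∈ₛ ⁅ p ⁆
    only-p {w} vw with w Fin.≟ p
    ... | yes refl = Subset.x∈⁅x⁆ p
    ... | no w≢p   = contradiction (w , vw , w≢p) ¬found
    singleton : tabulate (adj G v) ≡ ⁅ p ⁆
    singleton = Subset.⊆-antisym (only-p ∘ ∈-tabulate⁻ₛ)
      (λ w∈ → ∈-tabulate⁺ₛ (subst (Adj G v) (≡-sym (Subset.x∈⁅y⁆⇒x≡y p w∈)) vp))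

  -- Outside `megSet`, `v` is neither root nor leaf, so it has a neighbour besides its parent; a
  -- non-tree edge to it would put `v` into `megSet`, so that neighbour is a child.
  child : ∀ {v} → ¬ (v ∈ₛ megSet) → ∃ λ w → Adj G w (par w) × par w ≡ v
  child {v} v∉S with other-neighbour (proj₁ (par-nonroot λ { refl → v∉S root∈megSet })) (v∉S ∘ leaf∈megSet)
  ... | w , vw , w≢pv with par w Fin.≟ v
  ... | yes refl = w , Adj-sym vw , refl
  ... | no pw≢v  = contradiction (proj₁ (nonTree⊆megSet vw λ
                     { (inj₁ pv≡w) → w≢pv (≡-sym pv≡w) ; (inj₂ pw≡v) → pw≢v pw≡v })) v∉S

  maxDist : ∃ λ m → ∀ x → dist x ≤ m
  maxDist = bounded dist

  -- `fuel` bounds the height of the tree that is left below v.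
  descend : ∀ fuel v → proj₁ maxDist < dist v + fuel → Σ (Fin n) λ x → x ∈ₛ megSet × Through x v
  descend zero v lt = contradiction (≤-trans lt (≤-reflexive (+-identityʳ _))) (≤⇒≯ (proj₂ maxDist v))
  descend (suc fuel) v lt with v Subset.∈? megSet
  ... | yes v∈S = v , v∈S , through-refl v
  ... | no v∉S with child v∉S
  ... | w , wv , refl with descend fuel w (≤-trans lt (≤-reflexive (trans (+-suc _ fuel)
                             (cong (_+ fuel) (proj₂ (par-nonroot (Adj-par⇒≢r wv)))))))
  -- Since `v`, the parent of `w`, lies outside `megSet`, `w` has no other closer neighbour, and
  -- geodesics through `w` continue to `v`.
  ... | x , x∈S , thr = x , x∈S , through-par (Adj-par⇒≢r wv) (parentUnique (v∉S ∘ proj₂)) thr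

  MonitoredBy-megSet : Fin n → Fin n → Set
  MonitoredBy-megSet u v = Σ (Fin n) λ x → Σ (Fin n) λ y → x ∈ₛ megSet × y ∈ₛ megSet × Monitors G x y u v

  treeEdge-monitored : ∀ {v} → Adj G v (par v) → MonitoredBy-megSet v (par v)
  treeEdge-monitored {v} vp with (v Subset.∈? megSet) ×-dec (par v Subset.∈? megSet)
  ... | yes (v∈S , p∈S) = v , par v , v∈S , p∈S , endpoints-monitor vp
  -- One more than the maximal distance is enough fuel from any starting level.
  ... | no ∉S with descend (suc (proj₁ maxDist)) v (m≤n+m _ (dist v))
  ... | x , x∈S , thr = x , r , x∈S , root∈megSet , through⇒monitors (Adj-par⇒≢r vp) (parentUnique ∉S) thr

  megSet-isMEGSet : IsMEGSet G megSet
  megSet-isMEGSet u v uv with par u Fin.≟ v | par v Fin.≟ u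
  ... | yes refl | _        = treeEdge-monitored uv
  ... | no _     | yes refl with treeEdge-monitored (Adj-sym uv)
  ... | x , y , x∈S , y∈S , mon = x , y , x∈S , y∈S , λ w sh → usesEdge-swap (mon w sh)
  megSet-isMEGSet u v uv | no pu≢v | no pv≢u
    with nonTree⊆megSet uv (λ { (inj₁ pu≡v) → pu≢v pu≡v ; (inj₂ pv≡u) → pv≢u pv≡u })
  ... | u∈S , v∈S = u , v , u∈S , v∈S , endpoints-monitor uv

  ∣megSet∣≤ : ∀ {F} → IsFeedbackEdgeSet G F → ∣ megSet ∣ ≤ suc (3 * length F) + numLeaves G
  ∣megSet∣≤ {F} fes = begin
    ∣ megSet ∣                                  ≤⟨ ∣adjoin∣≤ chosen leaves ⟩
    length chosen + numLeaves G                 ≡⟨ cong (λ m → suc m + numLeaves G) (length-triples nonTreeEdges) ⟩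
    suc (3 * length nonTreeEdges) + numLeaves G ≤⟨ +-monoˡ-≤ (numLeaves G) (s≤s (*-monoʳ-≤ 3 (∣nonTreeEdges∣≤ fes))) ⟩
    suc (3 * length F) + numLeaves G            ∎
    where open ≤-Reasoning

3k+1+ℓ≤9k+ℓ∸8 : ∀ k ℓ → 2 ≤ k → suc (3 * k) + ℓ ≤ 9 * k + ℓ ∸ 8
3k+1+ℓ≤9k+ℓ∸8 (suc (suc k)) ℓ (s≤s (s≤s z≤n)) = m+n≤o⇒m≤o∸n _ (begin
  -- With `2 + k` feedback edges, the slack between the two bounds is exactly `3 + 6 * k`.
  suc (3 * (2 + k)) + ℓ + 8                 ≤⟨ m≤m+n _ (3 + 6 * k) ⟩
  suc (3 * (2 + k)) + ℓ + 8 + (3 + 6 * k)   ≡⟨ identity k ℓ ⟩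
  9 * (2 + k) + ℓ                           ∎)
  where
  open ≤-Reasoning
  identity : ∀ k ℓ → suc (3 * (2 + k)) + ℓ + 8 + (3 + 6 * k) ≡ 9 * (2 + k) + ℓ
  identity = solve-∀

theorem8 : ∀ (n : ℕ) (G : Graph n) → Connected G →
    (F : List (Fin n × Fin n)) → IsMinFeedbackEdgeSet G F → 2 ≤ length F →
    Σ (Subset n) λ S → IsMEGSet G S × ∣ S ∣ ≤ 9 * length F + numLeaves G ∸ 8
-- As `F` is nonempty, an end of its first edge can serve as the root.
theorem8 n G conn F@((r , _) ∷ _) (fes , _) 2≤k =
  megSet , megSet-isMEGSet , ≤-trans (∣megSet∣≤ fes) (3k+1+ℓ≤9k+ℓ∸8 (length F) (numLeaves G) 2≤k)
  where open BFS G conn r
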